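{- There is no abstract factorial with three consecutive equal factorials; that is, there are no abstract factorial $!_{a}$ and $k\in\mathbb{N}$ with $k!_{a}=(k+1)!_{a}=(k+2)!_{a}$.
   Context: $\mathbb{N}=\{0,1,2,\dots\}$ and $\mathbb{Z}^+=\{1,2,3,\dots\}$. An abstract factorial is a function $!_{a}:\mathbb{N}\to\mathbb{Z}^+$, $n\mapsto n!_{a}$, such that: (1) $0!_{a}=1$; (2) for all integers $0\le k\le n$, the generalized binomial coefficient $\binom{n}{k}_{a}:=\frac{n!_{a}}{k!_{a}\,(n-k)!_{a}}$ is a positive integer; (3) for every positive integer $n$, the ordinary factorial $n!$ divides $n!_{a}$. The values $n!_{a}$ are called its factorials. -}

module Defs where

open import Data.Integer.Base using (+_)
open import Data.Nat.Base using (ℕ; _*_; _∸_; _≤_; _!; NonZero)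
open import Data.Nat.Divisibility using (_∣_)
open import Data.Nat.Properties using (m*n≢0)
open import Data.Product.Base using (∃-syntax; _×_)
open import Data.Rational.Base using (ℚ; _/_)
open import Relation.Binary.PropositionalEquality.Core using (_≡_)

IsPositiveInteger : ℚ → Set
IsPositiveInteger q = ∃[ m ] NonZero m × q ≡ + m / 1

-- The truncated subtraction n ∸ k is the true difference only when k ≤ n.
binomial : (f : ℕ → ℕ) → (∀ n → NonZero (f n)) → ℕ → ℕ → ℚ
binomial f f≢0 n k =
  _/_ (+ f n) (f k * f (n ∸ k))
    {{m*n≢0 (f k) (f (n ∸ k)) {{f≢0 k}} {{f≢0 (n ∸ k)}}}}

record AbstractFactorial : Set where
  field
    factorial         : ℕ → ℕ
    factorial-nonZero : ∀ n → NonZero (factorial n)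
    factorial-0       : factorial 0 ≡ 1
    binomial-integral : ∀ n k → k ≤ n →
                        IsPositiveInteger (binomial factorial factorial-nonZero n k)
    !∣factorial       : ∀ n → .{{NonZero n}} → n ! ∣ factorial n

{-# OPTIONS --safe #-}
module Submission where

open import Data.Integer.Base using (+_)
open import Data.Nat.Base using (_+_; _*_; _∸_; _≤_; NonZero)
open import Data.Nat.Divisibility using (_∣_; divides; *-cancelˡ-∣; ∣-trans; >⇒∤)
open import Data.Nat.Properties using (*-identityʳ; m*n≢0; m≤m+n; m+n∸m≡n; n<1+n)
open import Data.Product.Base using (Σ-syntax; ∃-syntax; _×_; _,_)
open import Data.Rational.Base using (_/_)
open import Data.Rational.Properties using (normalize-injective-≃)
open import Relation.Binary.PropositionalEquality.Core using (_≡_; subst; sym; trans)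
open import Relation.Nullary.Negation.Core using (¬_)
open import Defs using (AbstractFactorial; IsPositiveInteger)
open AbstractFactorial using (factorial; factorial-nonZero; binomial-integral; !∣factorial)

-- Integrality of the binomial coefficients means that k!ₐ * j!ₐ divides (k+j)!ₐ. If k!ₐ = (k+j)!ₐ,
-- cancelling the nonzero k!ₐ leaves j!ₐ ∣ 1 (`factorial-≡⇒∣1`). At j = 2 this is impossible, since
-- 2! ∣ 2!ₐ.

-- Cross-multiplying `+ m / d ≡ + q / 1` gives `m * 1 ≡ q * d`, so `q` is itself the quotient; this
-- carries integrality from ℚ to ℕ.
isPositiveInteger⇒∣ : ∀ m d {{_ : NonZero d}} → IsPositiveInteger (+ m / d) → d ∣ m
isPositiveInteger⇒∣ m d (q , _ , m/d≡q) =
  divides q (trans (sym (*-identityʳ m)) (normalize-injective-≃ m q d 1 m/d≡q))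

factorial-*-∣ : ∀ a {n k} → k ≤ n → factorial a k * factorial a (n ∸ k) ∣ factorial a n
factorial-*-∣ a {n} {k} k≤n =
  isPositiveInteger⇒∣ (factorial a n) (factorial a k * factorial a (n ∸ k))
    {{m*n≢0 _ _ {{factorial-nonZero a k}} {{factorial-nonZero a (n ∸ k)}}}}
    (binomial-integral a n k k≤n)

-- With the upper index written as `k + j`, the truncated subtraction is exact and disappears.
factorial-*-∣-+ : ∀ a k j → factorial a k * factorial a j ∣ factorial a (k + j)
factorial-*-∣-+ a k j =
  subst (λ i → factorial a k * factorial a i ∣ factorial a (k + j))
    (m+n∸m≡n k j) (factorial-*-∣ a (m≤m+n k j))

factorial-≡⇒∣1 : ∀ a k j → factorial a k ≡ factorial a (k + j) → factorial a j ∣ 1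
factorial-≡⇒∣1 a k j eq =
  *-cancelˡ-∣ (factorial a k) {{factorial-nonZero a k}}
    (subst (factorial a k * factorial a j ∣_)
      -- Rewrites (k+j)!ₐ as k!ₐ * 1, exposing the common factor to cancel.
      (trans (sym eq) (sym (*-identityʳ (factorial a k)))) (factorial-*-∣-+ a k j))

-- If k!ₐ = (k+2)!ₐ, then the binomial coefficient of k+2 over k
-- is 1 / 2!ₐ, so 2!ₐ = 1, whereas 2 = 2! divides 2!ₐ.
lemma8 : ¬ (Σ[ a ∈ AbstractFactorial ] ∃[ k ] (factorial a k ≡ factorial a (k + 1) × factorial a (k + 1) ≡ factorial a (k + 2)))
lemma8 (a , k , eq₁ , eq₂) =
  >⇒∤ (n<1+n 1) (∣-trans (!∣factorial a 2) (factorial-≡⇒∣1 a k 2 (trans eq₁ eq₂)))
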